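{- There is a family $\{t_n\}_{n\in\mathbb N}$ of closed $\lambda$-terms such that there is a complete evaluation $\rho_n:t_n\to_{wh}^{n}u_n$ simulated by Space KAM runs $\sigma_n$ taking both space and time exponential in $n$, that is, $|\sigma_n|_{\mathsf{sp}}=|\sigma_n|_{\mathsf{tm}}=\Omega(2^n)$ (both quantities are $\Omega(2^n)$).
   Context: **$\lambda$-terms.** $t,u::=x\mid\lambda x.t\mid t\,u$, up to $\alpha$-equivalence. Weak head reduction: $(\lambda x.t)\,u\,r_1\cdots r_h\to_{wh}t\{x{\leftarrow}u\}\,r_1\cdots r_h$ ($h\ge0$). A sequence is complete if it ends on a normal term. **Space KAM.** Environments $e::=\epsilon\mid[x{\leftarrow}c]\cdot e$, closures $c=(t,e)$, stacks $\pi::=\epsilon\mid c\cdot\pi$; states are triples $(t,e,\pi)$, with an immutable closed code $t_0$. $e(x)$ is the closure associated to $x$ in $e$; $e|_t$ is the restriction of $e$ to the free variables $\mathsf{fv}(t)$ of $t$. The initial state for closed $t_0$ has code $t_0$ and is $(t_0,\epsilon,\epsilon)$. Transitions: - $(t\,x,e,\pi)\to(t,e|_t,e(x)\cdot\pi)$; - $(t\,u,e,\pi)\to(t,e|_t,(u,e|_u)\cdot\pi)$ if $u$ is not a variable; - $(\lambda x.t,e,c\cdot\pi)\to(t,e,\pi)$ if $x\notin\mathsf{fv}(t)$; - $(\lambda x.t,e,c\cdot\pi)\to(t,[x{\leftarrow}c]\cdot e,\pi)$ if $x\in\mathsf{fv}(t)$; - $(x,e,\pi)\to(u,e',\pi)$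 if $e(x)=(u,e')$. $\sigma_n$ simulates $\rho_n$ when it is the complete run from the initial state for $t_n$. **Costs.** Every term $u$ in a reachable state is a sub-term (occurrence) of $t_0$ and costs the bit-length of its left address, i.e. of the index in binary of its root constructor in the in-order enumeration of the constructors of $t_0$ (application: left sub-term, then the application, then right sub-term; abstraction: the abstraction, then the body); variables of environment entries are pointers to their binder, costed likewise. Environments, closures and stacks are flat strings (no sharing, no pointers between them), so the space of a state is the sum of the costs of its components (code not counted); $|\sigma|_{\mathsf{sp}}$ is the maximum space of a state of $\sigma$. Each transition has time cost polynomial in the size of its whole source state (data structures are copied and rewritten as strings, so manipulating a state of size $s$ costs at least the space it occupies); $|\sigma|_{\mathsf{tm}}$ is the sum of the time costs of the transitions. -}

module Defs where

open import Data.Bool.Base using (if_then_else_)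
open import Data.Fin.Base using (Fin)
open import Data.Fin.Substitution using (Sub; Lift; TermSubst)
open import Data.List.Base as List using (List; []; _∷_; [_]; _++_)
open import Data.List.Membership.DecPropositional using (_∈?_)
open import Data.List.Membership.Propositional using (_∈_)
open import Data.Maybe.Base using (Maybe; just; nothing)
open import Data.Nat.Base using (ℕ; suc; _+_; _*_; _^_; _⊔_; _≤_; _<_; _≡ᵇ_)
open import Data.Nat.ListAction using (sum)
open import Data.Nat.Logarithm using (⌊log₂_⌋)
open import Data.Nat.Properties using (_≟_)
open import Data.Product.Base using (_×_; _,_; proj₁; ∃-syntax)
open import Data.Vec.Base as Vec using (Vec; []; _∷_)
open import Level using (0ℓ)
open import Relation.Binary.Core using (Rel)
open import Relation.Binary.Construct.Closure.ReflexiveTransitive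
  using (Star; ε; _◅_; fold)
open import Relation.Binary.PropositionalEquality.Core using (_≡_)
open import Relation.Binary.Rewriting using (IsNormalForm)
open import Relation.Nullary.Decidable.Core using (¬?)
open import Relation.Nullary.Negation.Core using (¬_)

------------------------------------------------------------------------
-- λ-terms

-- Well-scoped de Bruijn terms: α-equivalence is equality, and the closed
-- terms are those of type Tm 0.

infixl 9 _·_

data Tm (n : ℕ) : Set where
  var : Fin n → Tm n
  ƛ   : Tm (suc n) → Tm n
  _·_ : Tm n → Tm n → Tm n

module TmApp {T : ℕ → Set} (l : Lift T Tm) where
  open Lift l hiding (var)

  infixl 8 _/_

  _/_ : ∀ {m n} → Tm m → Sub T m n → Tm n
  var x   / ρ = lift (Vec.lookup ρ x)
  ƛ t     / ρ = ƛ (t / ρ ↑)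
  (t · u) / ρ = (t / ρ) · (u / ρ)

tmSubst : TermSubst Tm
tmSubst = record { var = var ; app = TmApp._/_ }

module TmSubst = TermSubst tmSubst

infix 10 _[_]₀

_[_]₀ : ∀ {n} → Tm (suc n) → Tm n → Tm n
t [ u ]₀ = t TmSubst./ TmSubst.sub u

------------------------------------------------------------------------
-- Weak head reduction

infixl 8 _·*_

_·*_ : ∀ {n} → Tm n → List (Tm n) → Tm n
t ·* rs = List.foldl _·_ t rs

infix 4 _→wh_

data _→wh_ {n : ℕ} : Rel (Tm n) 0ℓ where
  β : ∀ t u rs → ƛ t · u ·* rs →wh t [ u ]₀ ·* rs

------------------------------------------------------------------------
-- Complete sequences

record Complete {A : Set} (_⟶_ : Rel A 0ℓ) (a : A) : Set where
  field
    {end}    : A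
    sequence : Star _⟶_ a end
    normal   : IsNormalForm _⟶_ end

open Complete public

length : ∀ {A : Set} {_⟶_ : Rel A 0ℓ} {a b} → Star _⟶_ a b → ℕ
length = fold (λ _ _ → ℕ) (λ _ k → suc k) 0

------------------------------------------------------------------------
-- Code

Addr : Set
Addr = ℕ

-- The code run by the machine is the initial term with every constructor
-- carrying its own left address, so that a piece of code denotes one
-- particular sub-term occurrence.  In  lam a t  the bound variable is named
-- by the address a of its binder; in  var a x  the address of the occurrence
-- is a, and x is the address of its binder.  Distinct binders therefore bind
-- distinct names.

data Code : Set where
  var : (a x : Addr) → Code
  lam : (a : Addr) → Code → Code
  app : (a : Addr) → Code → Code → Code

addr : Code → Addr
addr (var a _)   = a
addr (lam a _)   = a
addr (app a _ _) = a

constructors : ∀ {n} → Tm n → ℕ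
constructors (var _) = 1
constructors (ƛ t)   = suc (constructors t)
constructors (t · u) = constructors t + suc (constructors u)

-- label bs k t  annotates t with its in-order enumeration starting from k;
-- bs are the addresses of the binders in scope.

label : ∀ {n} → Vec Addr n → ℕ → Tm n → Code
label bs k (var i) = var k (Vec.lookup bs i)
label bs k (ƛ t)   = lam k (label (k ∷ bs) (suc k) t)
label bs k (t · u) = app root (label bs k t) (label bs (suc root) u)
  where
  root : Addr
  root = k + constructors t

code : Tm 0 → Code
code t = label [] 1 t

data IsVar : Code → Set where
  var : ∀ {a x} → IsVar (var a x)

-- A list representing a finite set: only membership matters.

fv : Code → List Addr
fv (var _ x)   = [ x ]
fv (lam x t)   = List.filter (λ y → ¬? (y ≟ x)) (fv t)
fv (app _ t u) = fv t ++ fv u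

------------------------------------------------------------------------
-- The Space KAM

data Closure : Set where
  ⟨_,_⟩ : Code → List (Addr × Closure) → Closure

-- An entry  (x , c)  is [x←c].

Env : Set
Env = List (Addr × Closure)

Stack : Set
Stack = List Closure

State : Set
State = Code × Env × Stack

lookup : Env → Addr → Maybe Closure
lookup []            x = nothing
lookup ((y , c) ∷ e) x = if x ≡ᵇ y then just c else lookup e x

infixl 9 _∣_

_∣_ : Env → Code → Env
e ∣ t = List.filter (λ entry → _∈?_ _≟_ (proj₁ entry) (fv t)) e

initial : Tm 0 → State
initial t₀ = code t₀ , [] , []

infix 4 _⟶_

data _⟶_ : Rel State 0ℓ where

  sea-var  : ∀ {a b t x e π c} → lookup e x ≡ just c →
             (app a t (var b x) , e , π) ⟶ (t , e ∣ t , c ∷ π)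

  sea-¬var : ∀ {a t u e π} → ¬ IsVar u →
             (app a t u , e , π) ⟶ (t , e ∣ t , ⟨ u , e ∣ u ⟩ ∷ π)

  β-weak   : ∀ {x t e c π} → ¬ x ∈ fv t →
             (lam x t , e , c ∷ π) ⟶ (t , e , π)

  β-¬weak  : ∀ {x t e c π} → x ∈ fv t →
             (lam x t , e , c ∷ π) ⟶ (t , (x , c) ∷ e , π)

  sub      : ∀ {a x u e e′ π} → lookup e x ≡ just ⟨ u , e′ ⟩ →
             (var a x , e , π) ⟶ (u , e′ , π)

Evaluation : Tm 0 → Set
Evaluation t = Complete _→wh_ t

Run : Tm 0 → Set
Run t = Complete _⟶_ (initial t)

------------------------------------------------------------------------
-- Space

-- The length of the binary representation of an address; addresses are
-- positive.

bits : Addr → ℕ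
bits a = suc ⌊log₂ a ⌋

mutual
  spaceᶜ : Closure → ℕ
  spaceᶜ ⟨ t , e ⟩ = bits (addr t) + spaceᵉ e

  spaceᵉ : List (Addr × Closure) → ℕ
  spaceᵉ []            = 0
  spaceᵉ ((x , c) ∷ e) = bits x + spaceᶜ c + spaceᵉ e

spaceˢ : State → ℕ
spaceˢ (t , e , π) = bits (addr t) + spaceᵉ e + sum (List.map spaceᶜ π)

space : ∀ {s s′} → Star _⟶_ s s′ → ℕ
space {s} ε       = spaceˢ s
space {s} (_ ◅ σ) = spaceˢ s ⊔ space σ

------------------------------------------------------------------------
-- Time

-- The admissible assignments of costs to transitions.  The cost may depend
-- on the whole immutable code t₀, but its bounds may not.

record TimeCost : Set where
  field
    cost               : (t₀ : Tm 0) → ∀ {s s′} → s ⟶ s′ → ℕ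
    space≤cost         : ∀ t₀ {s s′} (r : s ⟶ s′) → spaceˢ s ≤ cost t₀ r
    coefficient degree : ℕ
    cost-polynomial    : ∀ t₀ {s s′} (r : s ⟶ s′) →
                         cost t₀ r ≤ coefficient * spaceˢ s ^ degree

open TimeCost public

time : TimeCost → (t₀ : Tm 0) → ∀ {s s′} → Star _⟶_ s s′ → ℕ
time τ t₀ = fold (λ _ _ → ℕ) (λ r k → cost τ t₀ r + k) 0

------------------------------------------------------------------------
-- Asymptotics

-- f ∈Ω g  states  f n ≥ (1 / C) · g n  for all large enough n.

infix 4 _∈Ω_

_∈Ω_ : (f g : ℕ → ℕ) → Set
f ∈Ω g = ∃[ C ] ∃[ n₀ ] 0 < C × (∀ n → n₀ ≤ n → g n ≤ C * f n)

{-# OPTIONS --safe #-}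
-- Take t_n = (λx₁. (λx₂. … (λxₙ. λz. …) Vₙ …) V₂) V₁, where Vₖ mentions every
-- one of x₁, …, xₖ₋₁.  Weak head reduction fires the n visible redexes and
-- stops on the innermost abstraction.  Since no variable can be dropped, the
-- machine binds xₖ to the closure of Vₖ together with a full copy of the
-- current environment, and keeps that environment: every β doubles the space.
module Submission where

open import Data.Fin.Base using (Fin; zero; suc)
open import Data.Fin.Substitution using (Sub; Lift)
open import Data.List.Base using (List; []; _∷_; allFin)
open import Data.List.Membership.DecPropositional using (_∈?_)
open import Data.List.Membership.Propositional using (_∈_)
open import Data.List.Membership.Propositional.Properties
  using (∈-++⁺ʳ; ∈-filter⁺; ∈-allFin)
open import Data.List.Properties using (filter-all)
open import Data.List.Relation.Unary.All as All using (All; []; _∷_)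
open import Data.List.Relation.Unary.Any using (here; there)
open import Data.Nat.Base
  using (ℕ; zero; suc; _+_; _*_; _^_; _≤_; _<_; z≤n; s≤s)
open import Data.Nat.Properties using
  ( _≟_; <⇒≢; n<1+n; n≤1+n; m<n⇒m<1+n; m≤n+m; m≤n⊔m; +-identityʳ; +-mono-≤
  ; +-monoˡ-≤; *-identityˡ; *-identityʳ; *-assoc; *-comm; *-monoʳ-≤
  ; module ≤-Reasoning )
open import Data.Nat.Tactic.RingSolver using (solve-∀)
open import Data.Product.Base using (Σ-syntax; _×_; _,_; proj₁)
open import Data.Vec.Base as Vec using (Vec; []; _∷_)
open import Data.Vec.Membership.Propositional using () renaming (_∈_ to _∈ᵛ_)
open import Data.Vec.Relation.Unary.All as Allᵛ using ([]; _∷_) renaming (All to Allᵛ)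
open import Data.Vec.Relation.Unary.Any as Anyᵛ using (here; there)
open import Data.Vec.Relation.Unary.Any.Properties using (lookup-index)
open import Relation.Binary.Construct.Closure.ReflexiveTransitive
  using (ε; _◅_)
open import Relation.Binary.PropositionalEquality.Core
  using (_≡_; _≢_; refl; sym; cong; subst; subst₂)
open import Relation.Binary.Rewriting using (IsNormalForm)
open import Relation.Nullary.Decidable.Core using (¬?)
open import Relation.Nullary.Negation.Core using (¬_)
open import Defs

-- The family of terms

-- Ending with the identity ensures that a spine is never a variable, which
-- the machine would look up instead of packing into a closure.
spine : ∀ {k} → List (Fin k) → Tm k
spine []       = ƛ (var zero)
spine (i ∷ is) = var i · spine is

-- `m` counts the redexes still to fire, `k` the binders in scope. The last abstraction also lists
-- all variables, so that none is dropped along the way.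
tower : ℕ → ∀ k → Tm k
tower zero    k = ƛ (spine (allFin (suc k)))
tower (suc m) k = ƛ (tower m (suc k)) · spine (allFin k)

-- Weak head evaluation

-- Unlike being a tower, this shape is preserved by substitution.
data Redexes {k : ℕ} : ℕ → Tm k → Set where
  done : ∀ {t} → Redexes 0 (ƛ t)
  more : ∀ {m t u} → Redexes m t → Redexes (suc m) (ƛ t · u)

module _ {T : ℕ → Set} (l : Lift T Tm) where
  open TmApp l using (_/_)

  Redexes-/ : ∀ {j k m t} (s : Sub T j k) → Redexes m t → Redexes m (t / s)
  Redexes-/ s done     = done
  Redexes-/ s (more r) = more (Redexes-/ (s ↑) r)
    where open Lift l using (_↑)

tower-redexes : ∀ m k → Redexes m (tower m k)
tower-redexes zero    k = done
tower-redexes (suc m) k = more (tower-redexes m (suc k))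

-- Arguments fold from the left, so recursion absorbs `r` into the head, which remains an
-- application.
·-·*≢ƛ : ∀ {k} {t u : Tm k} {v} rs → t · u ·* rs ≢ ƛ v
·-·*≢ƛ []       ()
·-·*≢ƛ (r ∷ rs) eq = ·-·*≢ƛ rs eq

ƛ-normal : ∀ {k} {t : Tm (suc k)} → IsNormalForm _→wh_ (ƛ t)
ƛ-normal (_ , red) = go red refl
  where
  -- Matching `β` against an abstraction would get stuck on `_·*_`, so the shape of the source is a
  -- separate equation.
  go : ∀ {t u v} → t →wh u → t ≢ ƛ v
  go (β _ _ rs) = ·-·*≢ƛ rs

infixr 5 _◅ᶜ_

_◅ᶜ_ : ∀ {A : Set} {_⟶_ : A → A → Set} {a b} →
       a ⟶ b → Complete _⟶_ b → Complete _⟶_ a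
r ◅ᶜ c = record { sequence = r ◅ sequence c ; normal = normal c }

evaluate : ∀ {k m} {t : Tm k} → Redexes m t → Complete _→wh_ t
evaluate done = record { sequence = ε ; normal = ƛ-normal }
evaluate (more {t = t} {u} r) =
  β t u [] ◅ᶜ evaluate (Redexes-/ TmSubst.termLift (TmSubst.sub u) r)

length-evaluate : ∀ {k m} {t : Tm k} (r : Redexes m t) →
                  length (sequence (evaluate r)) ≡ m
length-evaluate done = refl
length-evaluate (more {u = u} r) =
  cong suc (length-evaluate (Redexes-/ TmSubst.termLift (TmSubst.sub u) r))

-- Free variables of labelled code

∈-fv-lam : ∀ {x y} t → y < x → y ∈ fv t → y ∈ fv (lam x t)
∈-fv-lam {x} t y<x y∈t = ∈-filter⁺ (λ y → ¬? (y ≟ x)) y∈t (<⇒≢ y<x)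

∈-fv-spine : ∀ {k} (bs : Vec Addr k) a {i is} → i ∈ is →
             Vec.lookup bs i ∈ fv (label bs a (spine is))
∈-fv-spine bs a (here refl) = here refl
∈-fv-spine bs a (there i∈)  = there (∈-fv-spine bs _ i∈)

∈-fv-full-spine : ∀ {k} (bs : Vec Addr k) a {x} → x ∈ᵛ bs →
                  x ∈ fv (label bs a (spine (allFin k)))
∈-fv-full-spine {k} bs a x∈ =
  subst (_∈ fv (label bs a (spine (allFin k)))) (sym (lookup-index x∈))
    (∈-fv-spine bs a (∈-allFin (Anyᵛ.index x∈)))

-- Binders are named by addresses, which grow inwards: a name in scope differs from the next binder
-- `a`, so abstracting over `a` leaves it free.
Below : ∀ {k} → Vec Addr k → Addr → Set
Below bs a = Allᵛ (_< a) bs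

below-∷ : ∀ {k a} {bs : Vec Addr k} → Below bs a → Below (a ∷ bs) (suc a)
below-∷ bs<a = n<1+n _ ∷ Allᵛ.map m<n⇒m<1+n bs<a

-- Case analysis suffices: the outermost argument, or the last body, already lists every binder in
-- scope.
∈-fv-tower : ∀ m {k} (bs : Vec Addr k) a {x} → Below bs a → x ∈ᵛ bs →
             x ∈ fv (label bs a (tower m k))
∈-fv-tower zero {k} bs a bs<a x∈ =
  ∈-fv-lam (label (a ∷ bs) (suc a) (spine (allFin (suc k))))
    (Allᵛ.lookup bs<a x∈) (∈-fv-full-spine (a ∷ bs) (suc a) (there x∈))
∈-fv-tower (suc m) {k} bs a bs<a x∈ =
  ∈-++⁺ʳ (fv (label bs a (ƛ (tower m (suc k))))) (∈-fv-full-spine bs _ x∈)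

-- Runs of the machine

∣-all : ∀ {e} t → All (λ entry → proj₁ entry ∈ fv t) e → e ∣ t ≡ e
∣-all t = filter-all (λ entry → _∈?_ _≟_ (proj₁ entry) (fv t))

spine-¬var : ∀ {k} {bs : Vec Addr k} {a} is → ¬ IsVar (label bs a (spine is))
spine-¬var []       ()
spine-¬var (_ ∷ _) ()

lam-normal : ∀ {a t e} → IsNormalForm _⟶_ (lam a t , e , [])
lam-normal (_ , ())

sea-keep : ∀ {a t u e π} → ¬ IsVar u → e ∣ t ≡ e → e ∣ u ≡ e →
           (app a t u , e , π) ⟶ (t , e , ⟨ u , e ⟩ ∷ π)
sea-keep {a} {t} {u} {e} {π} ¬var e∣t≡e e∣u≡e =
  subst₂ (λ e₁ e₂ → (app a t u , e , π) ⟶ (t , e₁ , ⟨ u , e₂ ⟩ ∷ π))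
    e∣t≡e e∣u≡e (sea-¬var ¬var)

-- Invariant of the run: every entry is named by a binder in scope, hence survives restriction to
-- either side of the application.
Binds : ∀ {k} → Vec Addr k → Env → Set
Binds bs = All (λ entry → proj₁ entry ∈ᵛ bs)

module Round (m {k} : ℕ) {bs : Vec Addr k} {a : Addr} {e : Env}
             (bs<a : Below bs a) (bound : Binds bs e) where

  body argument : Code
  body     = label (a ∷ bs) (suc a) (tower m (suc k))
  -- In-order labelling resumes just after the root of the application.
  argument = label bs (suc (a + constructors (ƛ (tower m (suc k)))))
               (spine (allFin k))

  middle : State
  middle = lam a body , e , ⟨ argument , e ⟩ ∷ []

  extended : Env
  extended = (a , ⟨ argument , e ⟩) ∷ e

  extended-binds : Binds (a ∷ bs) extended
  extended-binds = here refl ∷ All.map there bound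

  sea : (label bs a (tower (suc m) k) , e , []) ⟶ middle
  sea = sea-keep (spine-¬var (allFin k))
    (∣-all (lam a body) (All.map keep bound))
    (∣-all argument (All.map (∈-fv-full-spine bs _) bound))
    where
    keep : ∀ {x} → x ∈ᵛ bs → x ∈ fv (lam a body)
    keep x∈ = ∈-fv-lam body (Allᵛ.lookup bs<a x∈)
      (∈-fv-tower m (a ∷ bs) (suc a) (below-∷ bs<a) (there x∈))

  β-bind : middle ⟶ (body , extended , [])
  β-bind = β-¬weak (∈-fv-tower m (a ∷ bs) (suc a) (below-∷ bs<a) (here refl))

run : ∀ m {k} {bs : Vec Addr k} {a e} → Below bs a → Binds bs e →
      Complete _⟶_ (label bs a (tower m k) , e , [])
run zero    bs<a bound = record { sequence = ε ; normal = lam-normal }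
run (suc m) bs<a bound = sea ◅ᶜ β-bind ◅ᶜ run m (below-∷ bs<a) extended-binds
  where open Round m bs<a bound

-- Exponential growth

double-≤ : ∀ {p} q s → 2 * s ≤ p → (2 * q) * s ≤ q * p
double-≤ {p} q s 2s≤p = begin
  (2 * q) * s ≡⟨ cong (_* s) (*-comm 2 q) ⟩
  (q * 2) * s ≡⟨ *-assoc q 2 s ⟩
  q * (2 * s) ≤⟨ *-monoʳ-≤ q 2s≤p ⟩
  q * p       ∎
  where open ≤-Reasoning

module _ (m {k} : ℕ) {bs : Vec Addr k} {a : Addr} {e : Env}
         (bs<a : Below bs a) (bound : Binds bs e) where
  open Round m bs<a bound

  -- Both sides have the same components: `a` is first the address of the code, then the name of the
  -- new entry.
  space-extended : spaceᵉ extended ≡ spaceˢ middle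
  space-extended = rearrange (bits a) (bits (addr argument)) (spaceᵉ e)
    where
    rearrange : ∀ x y s → x + (y + s) + s ≡ x + s + (y + s + 0)
    rearrange = solve-∀

  -- The state holds `e` twice and two addresses of at least one bit each. The `suc` starts the
  -- doubling from the empty environment, of space 0.
  space-middle : 2 * suc (spaceᵉ e) ≤ spaceˢ middle
  space-middle = begin
    2 * suc s             ≡⟨ rearrange s ⟩
    1 + s + (1 + s + 0)   ≤⟨ +-mono-≤ (+-monoˡ-≤ s (s≤s z≤n))
                               (+-monoˡ-≤ 0 (+-monoˡ-≤ s (s≤s z≤n))) ⟩
    spaceˢ middle         ∎
    where
    open ≤-Reasoning
    s : ℕ
    s = spaceᵉ e
    rearrange : ∀ s → 2 * suc s ≡ 1 + s + (1 + s + 0)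
    rearrange = solve-∀

  space-doubles : 2 * suc (spaceᵉ e) ≤ suc (spaceᵉ extended)
  space-doubles = begin
    2 * suc (spaceᵉ e)    ≤⟨ space-middle ⟩
    spaceˢ middle         ≡⟨ space-extended ⟨
    spaceᵉ extended       ≤⟨ n≤1+n _ ⟩
    suc (spaceᵉ extended) ∎
    where open ≤-Reasoning

space-run : ∀ m {k} {bs : Vec Addr k} {a e}
            (bs<a : Below bs a) (bound : Binds bs e) →
            2 ^ m * suc (spaceᵉ e) ≤ space (sequence (run m bs<a bound))
space-run zero {a = a} {e} bs<a bound = begin
  1 * suc (spaceᵉ e)    ≡⟨ *-identityˡ _ ⟩
  1 + spaceᵉ e          ≤⟨ +-monoˡ-≤ (spaceᵉ e) (s≤s z≤n) ⟩
  bits a + spaceᵉ e     ≡⟨ +-identityʳ _ ⟨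
  bits a + spaceᵉ e + 0 ∎
  where open ≤-Reasoning
space-run (suc m) {k} {bs} {a} {e} bs<a bound = begin
  2 ^ suc m * suc (spaceᵉ e)
    -- One factor 2 of the power is traded for the growth of the environment.
    ≤⟨ double-≤ (2 ^ m) (suc (spaceᵉ e)) (space-doubles m bs<a bound) ⟩
  2 ^ m * suc (spaceᵉ extended)
    ≤⟨ space-run m (below-∷ bs<a) extended-binds ⟩
  space σ
    ≤⟨ m≤n⊔m (spaceˢ middle) (space σ) ⟩
  space (β-bind ◅ σ)
    ≤⟨ m≤n⊔m (spaceˢ (label bs a (tower (suc m) k) , e , []))
         (space (β-bind ◅ σ)) ⟩
  space (sea ◅ β-bind ◅ σ)
    ∎
  where
  open ≤-Reasoning
  open Round m bs<a bound
  σ = sequence (run m (below-∷ bs<a) extended-binds)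

-- The final state is the source of no transition, so the time is bounded by
-- the space of the last state before it; hence at least one round is needed.
time-run : ∀ τ t₀ m {k} {bs : Vec Addr k} {a e}
           (bs<a : Below bs a) (bound : Binds bs e) →
           2 ^ suc m * suc (spaceᵉ e) ≤
             time τ t₀ (sequence (run (suc m) bs<a bound))
time-run τ t₀ zero {e = e} bs<a bound = begin
  2 * suc (spaceᵉ e)                        ≤⟨ space-middle zero bs<a bound ⟩
  spaceˢ middle                             ≤⟨ space≤cost τ t₀ β-bind ⟩
  cost τ t₀ β-bind                          ≡⟨ +-identityʳ _ ⟨
  cost τ t₀ β-bind + 0                      ≤⟨ m≤n+m _ (cost τ t₀ sea) ⟩
  cost τ t₀ sea + (cost τ t₀ β-bind + 0)    ∎
  where
  open ≤-Reasoning
  open Round zero bs<a bound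
time-run τ t₀ (suc m) {e = e} bs<a bound = begin
  2 ^ suc (suc m) * suc (spaceᵉ e)
    ≤⟨ double-≤ (2 ^ suc m) (suc (spaceᵉ e)) (space-doubles (suc m) bs<a bound) ⟩
  2 ^ suc m * suc (spaceᵉ extended)
    ≤⟨ time-run τ t₀ m (below-∷ bs<a) extended-binds ⟩
  time τ t₀ σ
    ≤⟨ m≤n+m _ (cost τ t₀ β-bind) ⟩
  time τ t₀ (β-bind ◅ σ)
    ≤⟨ m≤n+m _ (cost τ t₀ sea) ⟩
  time τ t₀ (sea ◅ β-bind ◅ σ)
    ∎
  where
  open ≤-Reasoning
  open Round (suc m) bs<a bound
  σ = sequence (run (suc m) (below-∷ bs<a) extended-binds)

proposition10p7 : Σ[ t ∈ (ℕ → Tm 0) ]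
    Σ[ ρ ∈ (∀ n → Evaluation (t n)) ]
    Σ[ σ ∈ (∀ n → Run (t n)) ]
    (∀ n → length (sequence (ρ n)) ≡ n)
    × (λ n → space (sequence (σ n))) ∈Ω (λ n → 2 ^ n)
    × (∀ τ → (λ n → time τ (t n) (sequence (σ n))) ∈Ω (λ n → 2 ^ n))
proposition10p7 =
    (λ n → tower n 0)
  , (λ n → evaluate (tower-redexes n 0))
  , (λ n → run n [] [])
  , (λ n → length-evaluate (tower-redexes n 0))
  , (1 , 0 , s≤s z≤n , λ n _ → scale (space-run n [] []))
  -- The threshold is 1: for `n = 0` the run has no transition and takes time 0.
  , (λ τ → 1 , 1 , s≤s z≤n ,
      λ { (suc m) _ → scale (time-run τ (tower (suc m) 0) m [] []) })
  where
  -- The factor 1 on the left is `suc (spaceᵉ [])`; the one on the right is the constant of `_∈Ω_`.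
  scale : ∀ {p q} → p * 1 ≤ q → p ≤ 1 * q
  scale {p} {q} p≤q = begin
    p     ≡⟨ *-identityʳ p ⟨
    p * 1 ≤⟨ p≤q ⟩
    q     ≡⟨ *-identityˡ q ⟨
    1 * q ∎
    where open ≤-Reasoning
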